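{- Let $\kappa$ be a regular uncountable cardinal and $\lambda>\kappa$ a cardinal. Suppose that $\alpha$ is an ordinal with $3\le\alpha\le\kappa$ and $H$ is an ideal on $P_\kappa(\lambda)$ such that $\mathrm{cof}(H)<\mathbf{non}_\kappa(J^+\to(J^+,\alpha)^2)$. Then $H^+\xrightarrow[\kappa]{\kappa}(H^+;\alpha)^2$.
   Context: For a cardinal $\mu$ and a set $A$, $P_\mu(A)=\{a\subseteq A:|a|<\mu\}$. An ideal on an infinite set $S$ is a collection $K$ of subsets of $S$ containing all singletons, closed under subsets and finite unions, with $S\notin K$; $K^+=P(S)\setminus K$; $\mathrm{cof}(K)$ is the least cardinality of an $X\subseteq K$ with $K=\bigcup_{A\in X}P(A)$. $K$ is $\kappa$-complete if it is closed under unions of fewer than $\kappa$ members. "Ideal on $\kappa$" always means $\kappa$-complete ideal on $\kappa$. $I_{\kappa,\lambda}$ is the set of all $A\subseteq P_\kappa(\lambda)$ such that $A\cap\{b\in P_\kappa(\lambda):a\subseteq b\}=\emptyset$ for some $a\in P_\kappa(\lambda)$. "Ideal on $P_\kappa(\lambda)$" always means a $\kappa$-complete ideal $H$ on $P_\kappa(\lambda)$ that is fine ($I_{\kappa,\lambda}\subseteq H$). For $A\subseteq\kappa$, $[A]^2=\{(\xi,\eta)\in A\times A:\xi<\eta\}$. For an ideal $J$ on $\kappa$, $J^+\to(J^+,\alpha)^2$ means: for every $A\in J^+$ and every $f:[A]^2\to2$ there is $B\subseteq A$ such that either $B\in J^+$ and $f$ is identically $0$ on $[B]^2$, or $B$ has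 order type $\alpha$ and $f$ is identically $1$ on $[B]^2$. $\mathbf{non}_\kappa(J^+\to(J^+,\alpha)^2)$ is the least cardinal $\tau$ such that there is an ideal $J$ on $\kappa$ with $\mathrm{cof}(J)=\tau$ for which $J^+\to(J^+,\alpha)^2$ fails. For $A\subseteq P_\kappa(\lambda)$, $[A]^2_{\kappa,\kappa}=\{(\bigcup(a\cap\kappa),\bigcup(b\cap\kappa)):a,b\in A,\ \bigcup(a\cap\kappa)<\bigcup(b\cap\kappa)\}$. $H^+\xrightarrow[\kappa]{\kappa}(H^+;\alpha)^2$ means: for every $F:[P_\kappa(\lambda)]^2_{\kappa,\kappa}\to2$ and every $A\in H^+$ there is $B\subseteq A$ such that either $B\in H^+$ and $F$ is identically $0$ on $[B]^2_{\kappa,\kappa}$, or $\{\bigcup(a\cap\kappa):a\in B\}$ has order type $\alpha$ and $F$ is identically $1$ on $[B]^2_{\kappa,\kappa}$. -}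

module Defs where

open import Axiom.ExcludedMiddle using (ExcludedMiddle)
open import Data.Bool.Base using (Bool; T)
open import Data.Empty.Polymorphic using (⊥; ⊥-elim)
open import Data.Fin.Base using (Fin)
open import Data.Fin.Patterns using (0F; 1F)
open import Data.Nat.Base using (ℕ; zero; suc)
open import Data.Product.Base using (Σ; ∃; Σ-syntax; ∃-syntax; _×_; _,_; proj₁; proj₂)
open import Data.Product.Relation.Binary.Pointwise.NonDependent using (_×ₛ_)
open import Data.Sum.Base using (_⊎_; [_,_])
open import Data.Unit.Polymorphic using (⊤)
open import Function.Base using (_∘_)
open import Function.Bundles using (Func; Injection; Bijection; _⇔_)
open import Level using (Level; Lift; _⊔_) renaming (suc to lsuc)
open import Relation.Binary.Bundles using (Setoid)
open import Relation.Binary.Morphism.Structures using (IsOrderIsomorphism)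
open import Relation.Binary.PropositionalEquality using (_≡_)
import Relation.Binary.Construct.On as On
import Relation.Binary.PropositionalEquality.Properties as ≡
open import Relation.Nullary.Decidable using (True)
open import Relation.Nullary.Negation using (¬_)
open import Relation.Unary using (Pred)

private
  variable
    ℓ p : Level

-- The set-theoretic universe: Aczel's iterative sets, compared by
-- extensional equality.  Given excluded middle and choice (assumed below as
-- explicit hypotheses), V is a model of ZFC, and all of the mathematics is
-- carried out inside it.

data V (ℓ : Level) : Set (lsuc ℓ) where
  sup : (A : Set ℓ) → (A → V ℓ) → V ℓ

Index : V ℓ → Set ℓ
Index (sup A f) = A

elem : (X : V ℓ) → Index X → V ℓ
elem (sup A f) = f

infix 4 _≈_ _∈_ _⊆_ _≤_ _≼_ _≺_ _≃_

_≈_ : V ℓ → V ℓ → Set ℓ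
sup A f ≈ sup B g = (∀ a → ∃[ b ] f a ≈ g b) × (∀ b → ∃[ a ] f a ≈ g b)

_∈_ : V ℓ → V ℓ → Set ℓ
x ∈ X = ∃[ i ] x ≈ elem X i

_⊆_ : V ℓ → V ℓ → Set (lsuc ℓ)
X ⊆ Y = ∀ x → x ∈ X → x ∈ Y

≈-refl : {x : V ℓ} → x ≈ x
≈-refl {x = sup A f} = (λ a → a , ≈-refl) , (λ a → a , ≈-refl)

≈-sym : {x y : V ℓ} → x ≈ y → y ≈ x
≈-sym {x = sup A f} {sup B g} (p , q) =
  (λ b → proj₁ (q b) , ≈-sym (proj₂ (q b))) ,
  (λ a → proj₁ (p a) , ≈-sym (proj₂ (p a)))

≈-trans : {x y z : V ℓ} → x ≈ y → y ≈ z → x ≈ z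
≈-trans {x = sup A f} {sup B g} {sup C h} (p , q) (r , s) =
  (λ a → let (b , e) = p a ; (c , e′) = r b in c , ≈-trans e e′) ,
  (λ c → let (b , e′) = s c ; (a , e) = q b in a , ≈-trans e e′)

V-setoid : (ℓ : Level) → Setoid (lsuc ℓ) ℓ
V-setoid ℓ = record
  { Carrier       = V ℓ
  ; _≈_           = _≈_
  ; isEquivalence = record { refl = ≈-refl ; sym = ≈-sym ; trans = ≈-trans }
  }

-- The elements of a set.  By replacement, setoid functions El X → El Y are
-- the same thing as the functions X → Y that are sets of ordered pairs.

El : V ℓ → Setoid (lsuc ℓ) ℓ
El {ℓ} X = On.setoid {B = ∃ (_∈ X)} (V-setoid ℓ) proj₁

Choice : (ℓ : Level) → Set (lsuc ℓ)
Choice ℓ = (X : V ℓ) → (∀ x → x ∈ X → ∃[ y ] y ∈ x) →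
  Σ[ c ∈ Func (El X) (V-setoid ℓ) ] (∀ x → Func.to c x ∈ proj₁ x)

∅ : V ℓ
∅ = sup ⊥ ⊥-elim

｛_｝ : V ℓ → V ℓ
｛ x ｝ = sup ⊤ (λ _ → x)

infixr 6 _∪_
infixr 7 _∩_

_∪_ : V ℓ → V ℓ → V ℓ
X ∪ Y = sup (Index X ⊎ Index Y) [ elem X , elem Y ]

_∩_ : V ℓ → V ℓ → V ℓ
X ∩ Y = sup (Σ[ i ∈ Index X ] elem X i ∈ Y) (elem X ∘ proj₁)

⋃ : V ℓ → V ℓ
⋃ X = sup (Σ[ i ∈ Index X ] Index (elem X i)) (λ (i , j) → elem (elem X i) j)

-- The set { F x : x ∈ X }.
image : (V ℓ → V ℓ) → V ℓ → V ℓ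
image F X = sup (Index X) (F ∘ elem X)

⌜_⌝ : ℕ → V ℓ
⌜ zero ⌝  = ∅
⌜ suc n ⌝ = ⌜ n ⌝ ∪ ｛ ⌜ n ⌝ ｝

ω : V ℓ
ω = sup (Lift _ ℕ) (⌜_⌝ ∘ Level.lower)

-- Cardinalities of arbitrary sets are compared by injections.

_≼_ : V ℓ → V ℓ → Set (lsuc ℓ)
X ≼ Y = Injection (El X) (El Y)

_≺_ : V ℓ → V ℓ → Set (lsuc ℓ)
X ≺ Y = X ≼ Y × ¬ (Y ≼ X)

_≃_ : V ℓ → V ℓ → Set (lsuc ℓ)
X ≃ Y = Bijection (El X) (El Y)

-- Von Neumann ordinals, ordered by ∈; cardinals are initial ordinals.

IsTransitive : V ℓ → Set (lsuc ℓ)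
IsTransitive X = ∀ x → x ∈ X → x ⊆ X

IsOrdinal : V ℓ → Set (lsuc ℓ)
IsOrdinal α = IsTransitive α × (∀ β → β ∈ α → IsTransitive β)

_≤_ : V ℓ → V ℓ → Set ℓ
α ≤ β = α ∈ β ⊎ α ≈ β

IsCardinal : V ℓ → Set (lsuc ℓ)
IsCardinal κ = IsOrdinal κ × (∀ β → β ∈ κ → ¬ (β ≃ κ))

Uncountable : V ℓ → Set (lsuc ℓ)
Uncountable X = ¬ (X ≼ ω)

-- For an infinite cardinal κ: no subset of κ of size less than κ is cofinal.
IsRegular : V ℓ → Set (lsuc ℓ)
IsRegular κ = ∀ X → X ⊆ κ → X ≺ κ → ∃[ β ] β ∈ κ × (∀ ξ → ξ ∈ X → ξ ∈ β)

-- For a set B of ordinals.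
HasOrderType : V ℓ → V ℓ → Set (lsuc ℓ)
HasOrderType B α = Σ[ f ∈ (Setoid.Carrier (El α) → Setoid.Carrier (El B)) ]
  IsOrderIsomorphism (Setoid._≈_ (El α)) (Setoid._≈_ (El B))
    (λ ξ η → proj₁ ξ ∈ proj₁ η) (λ ξ η → proj₁ ξ ∈ proj₁ η) f

record IsIdeal (S K : V ℓ) : Set (lsuc ℓ) where
  field
    infinite   : ω ≼ S
    subsets    : ∀ A → A ∈ K → A ⊆ S
    singletons : ∀ x → x ∈ S → ｛ x ｝ ∈ K
    downward   : ∀ A B → A ∈ K → B ⊆ A → B ∈ K
    unions     : ∀ A B → A ∈ K → B ∈ K → A ∪ B ∈ K
    proper     : ¬ (S ∈ K)

-- A ∈ K⁺, for K an ideal on S.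
Positive : V ℓ → V ℓ → V ℓ → Set (lsuc ℓ)
Positive S K A = A ⊆ S × ¬ (A ∈ K)

IsComplete : V ℓ → V ℓ → Set (lsuc ℓ)
IsComplete κ K = ∀ X → X ⊆ K → X ≺ κ → ⋃ X ∈ K

-- X ⊆ K and K is the union of the P(A), A ∈ X.
Generates : V ℓ → V ℓ → Set (lsuc ℓ)
Generates K X = X ⊆ K × (∀ B → B ∈ K ⇔ (∃[ A ] A ∈ X × B ⊆ A))

IsLeastCardinal : Pred (V ℓ) (lsuc ℓ) → V ℓ → Set (lsuc ℓ)
IsLeastCardinal P τ =
  IsCardinal τ × P τ × (∀ σ → IsCardinal σ → P σ → τ ≤ σ)

-- τ = cof(K)
IsCof : V ℓ → V ℓ → Set (lsuc ℓ)
IsCof K = IsLeastCardinal (λ τ → ∃[ X ] Generates K X × X ≃ τ)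

-- Sets of ordered pairs are represented by predicates on V × V.

Pairs : Pred (V ℓ × V ℓ) p → Setoid (lsuc ℓ ⊔ p) ℓ
Pairs {ℓ} C = On.setoid {B = ∃ C} (V-setoid ℓ ×ₛ V-setoid ℓ) proj₁

Colouring : Pred (V ℓ × V ℓ) p → Set (lsuc ℓ ⊔ p)
Colouring C = Func (Pairs C) (≡.setoid (Fin 2))

-- f is identically i on D (in use, D ⊆ C).
ConstantOn : {C : Pred (V ℓ × V ℓ) p} →
  Colouring C → Pred (V ℓ × V ℓ) p → Fin 2 → Set (lsuc ℓ ⊔ p)
ConstantOn f D i = ∀ x → D (proj₁ x) → Func.to f x ≡ i

[_]² : V ℓ → Pred (V ℓ × V ℓ) ℓ
[ A ]² (ξ , η) = ξ ∈ A × η ∈ A × ξ ∈ η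

IsIdealOnκ : V ℓ → V ℓ → Set (lsuc ℓ)
IsIdealOnκ κ J = IsIdeal κ J × IsComplete κ J

-- J⁺ → (J⁺, α)²
Arrow : (κ J α : V ℓ) → Set (lsuc ℓ)
Arrow κ J α = ∀ A → Positive κ J A → (f : Colouring [ A ]²) →
  ∃[ B ] B ⊆ A ×
    (  (Positive κ J B   × ConstantOn f [ B ]² 0F)
     ⊎ (HasOrderType B α × ConstantOn f [ B ]² 1F))

-- τ = non_κ(J⁺ → (J⁺, α)²)
IsNon : (κ α τ : V ℓ) → Set (lsuc ℓ)
IsNon κ α = IsLeastCardinal
  (λ τ → ∃[ J ] IsIdealOnκ κ J × IsCof J τ × ¬ Arrow κ J α)

-- ⋃(a ∩ κ)
height : V ℓ → V ℓ → V ℓ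
height κ a = ⋃ (a ∩ κ)

-- [A]²_{κ,κ}
[_]²κκ : V ℓ → V ℓ → Pred (V ℓ × V ℓ) (lsuc ℓ)
[ A ]²κκ κ (ξ , η) = ∃[ a ] ∃[ b ] a ∈ A × b ∈ A ×
  ξ ≈ height κ a × η ≈ height κ b × ξ ∈ η

-- Power sets and full separation exist in V only by excluded middle, which
-- makes subsets and propositions small.

module Classical {ℓ : Level} (em : ExcludedMiddle (lsuc ℓ)) where

  -- { x ∈ X : P x }, for P respecting ≈.
  sep : V ℓ → Pred (V ℓ) (lsuc ℓ) → V ℓ
  sep X P = sup (Σ[ i ∈ Index X ] True (em {P (elem X i)})) (elem X ∘ proj₁)

  𝒫 : V ℓ → V ℓ
  𝒫 X = sup (Index X → Bool) (λ χ → sup (Σ[ i ∈ Index X ] T (χ i)) (elem X ∘ proj₁))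

  -- P_μ(A)
  P : (μ A : V ℓ) → V ℓ
  P μ A = sep (𝒫 A) (_≺ μ)

  -- I_{κ,λ}
  I : (κ λ′ : V ℓ) → V ℓ
  I κ λ′ = sep (𝒫 (P κ λ′)) λ A →
    ∃[ a ] a ∈ P κ λ′ × (∀ b → b ∈ P κ λ′ → a ⊆ b → ¬ (b ∈ A))

  IsIdealOnP : (κ λ′ H : V ℓ) → Set (lsuc ℓ)
  IsIdealOnP κ λ′ H = IsIdeal (P κ λ′) H × IsComplete κ H × I κ λ′ ⊆ H

  -- H⁺ →^κ_κ (H⁺; α)²
  Arrowκκ : (κ λ′ H α : V ℓ) → Set (lsuc ℓ)
  Arrowκκ κ λ′ H α =
    (F : Colouring ([ P κ λ′ ]²κκ κ)) → ∀ A → Positive (P κ λ′) H A →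
    ∃[ B ] B ⊆ A ×
      (  (Positive (P κ λ′) H B                 × ConstantOn F ([ B ]²κκ κ) 0F)
       ⊎ (HasOrderType (image (height κ) B) α × ConstantOn F ([ B ]²κκ κ) 1F))

{-# OPTIONS --safe #-}
module Submission where

-- Push the ideal H restricted to A forward along the map a ↦ ⋃(a ∩ κ): the
-- sets B ⊆ κ with { a ∈ A : ⋃(a ∩ κ) ∈ B } ∈ H form an ideal J on κ.  Sending
-- Z ∈ H to the set of all ξ < κ whose whole fibre in A lies inside Z carries
-- a generating set of H to one of J, so cof(J) ≤ cof(H) and J satisfies the
-- partition relation on κ.  Applying it to the image of A, and pulling the
-- homogeneous set back, gives the relation for H.

open import Defs
open import Axiom.ExcludedMiddle using (ExcludedMiddle)
open import Data.Fin.Patterns using (0F; 1F)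
open import Data.Nat.Base as ℕ using (zero)
open import Data.Product.Base using (Σ-syntax; ∃-syntax; _×_; _,_; proj₁; proj₂)
open import Data.Sum.Base using (_⊎_; inj₁; inj₂)
open import Data.Unit.Polymorphic using (tt)
open import Function.Base using (_∘_)
open import Function.Bundles using (Func; Injection; Bijection; Equivalence; mk⇔)
import Function.Construct.Composition as Composition
import Function.Properties.Bijection as Bijections
import Function.Properties.Inverse as Inverses
open import Level using (Level; Lift; lift; lower; suc)
open import Relation.Binary.Bundles using (Setoid)
open import Relation.Binary.Morphism.Structures using (IsOrderIsomorphism)
open import Relation.Binary.PropositionalEquality using (trans)
open import Relation.Nullary.Decidable using (yes; no; ⌊_⌋; toWitness; fromWitness; map′; decidable-stable)
open import Relation.Nullary.Negation using (¬_; contradiction)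
open import Relation.Unary using (Pred)

private
  variable
    ℓ p : Level

-- A map on `V` acts on presentations of sets and may separate `≈`-equal ones; this condition makes
-- it an operation on sets proper.
Congruent : (V ℓ → V ℓ) → Set (suc ℓ)
Congruent h = ∀ x y → x ≈ y → h x ≈ h y

-- Membership

elem-∈ : (X : V ℓ) (i : Index X) → elem X i ∈ X
elem-∈ X i = i , ≈-refl {x = elem X i}

∈-respˡ : (x y X : V ℓ) → x ≈ y → x ∈ X → y ∈ X
∈-respˡ x y X x≈y (i , e) =
  i , ≈-trans {x = y} {x} {elem X i} (≈-sym {x = x} {y} x≈y) e

≈⇒⊆ : (X Y : V ℓ) → X ≈ Y → X ⊆ Y
≈⇒⊆ (sup A f) (sup B g) (p , _) x (a , e) =
  let (b , e′) = p a in b , ≈-trans {x = x} {f a} {g b} e e′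

≈⇒⊇ : (X Y : V ℓ) → X ≈ Y → Y ⊆ X
≈⇒⊇ X Y e = ≈⇒⊆ Y X (≈-sym {x = X} {Y} e)

⊆-antisym : (X Y : V ℓ) → X ⊆ Y → Y ⊆ X → X ≈ Y
⊆-antisym (sup A f) (sup B g) p q =
  (λ a → p (f a) (a , ≈-refl {x = f a})) ,
  (λ b → let (a , e) = q (g b) (b , ≈-refl {x = g b}) in a , ≈-sym {x = g b} {f a} e)

-- A member `y` of `sup A f` is only `≈` to some `f a`, and `P` is not assumed to respect `≈`. So
-- `below` proves `P` at every member of a set, recursing structurally into `f a`, which has the
-- same members as `y`.
∈-induction : (P : Pred (V ℓ) p) → (∀ x → (∀ y → y ∈ x → P y) → P x) → ∀ x → P x
∈-induction {ℓ} P step x = step x (below x)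
  where
  below : (x y : V ℓ) → y ∈ x → P y
  below (sup A f) y (a , e) = step y λ z z∈y → below (f a) z (≈⇒⊆ y (f a) e z z∈y)

∈-irrefl : (x : V ℓ) → ¬ (x ∈ x)
∈-irrefl = ∈-induction _ λ x ih x∈x → ih x x∈x x∈x

∩⁺ : (X Y x : V ℓ) → x ∈ X → x ∈ Y → x ∈ X ∩ Y
∩⁺ X Y x (i , e) x∈Y = (i , ∈-respˡ x (elem X i) Y e x∈Y) , e

∩⁻ : (X Y x : V ℓ) → x ∈ X ∩ Y → x ∈ X × x ∈ Y
∩⁻ X Y x ((i , i∈Y) , e) = (i , e) , ∈-respˡ (elem X i) x Y (≈-sym {x = x} {elem X i} e) i∈Y

⋃⁺ : (X x y : V ℓ) → y ∈ x → x ∈ X → y ∈ ⋃ X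
⋃⁺ X x y y∈x (i , e) = let (j , e′) = ≈⇒⊆ x (elem X i) e y y∈x in (i , j) , e′

⋃⁻ : (X y : V ℓ) → y ∈ ⋃ X → ∃[ x ] x ∈ X × y ∈ x
⋃⁻ X y ((i , j) , e) = elem X i , elem-∈ X i , j , e

⋃-mono : (X Y : V ℓ) → X ⊆ Y → ⋃ X ⊆ ⋃ Y
⋃-mono X Y X⊆Y y y∈⋃X =
  let (x , x∈X , y∈x) = ⋃⁻ X y y∈⋃X in ⋃⁺ Y x y y∈x (X⊆Y x x∈X)

｛｝-⊆ : (x X : V ℓ) → x ∈ X → ｛ x ｝ ⊆ X
｛｝-⊆ x X x∈X y (_ , e) = ∈-respˡ x y X (≈-sym {x = y} {x} e) x∈X

image⁺ : (h : V ℓ → V ℓ) → Congruent h → (X x : V ℓ) → x ∈ X → h x ∈ image h X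
image⁺ h h-cong X x (i , e) = i , h-cong x (elem X i) e

-- Membership is a small proposition, so it can be part of the index type and this separation is
-- constructive.
preimage : (V ℓ → V ℓ) → V ℓ → V ℓ → V ℓ
preimage h A B = sup (Σ[ i ∈ Index A ] h (elem A i) ∈ B) (elem A ∘ proj₁)

module _ (h : V ℓ → V ℓ) (h-cong : Congruent h) (A : V ℓ) where

  preimage⁺ : ∀ B a → a ∈ A → h a ∈ B → a ∈ preimage h A B
  preimage⁺ B a (i , e) ha∈B =
    (i , ∈-respˡ (h a) (h (elem A i)) B (h-cong a (elem A i) e) ha∈B) , e

  preimage⁻ : ∀ B a → a ∈ preimage h A B → a ∈ A × h a ∈ B
  preimage⁻ B a ((i , hi∈B) , e) = (i , e) ,
    ∈-respˡ (h (elem A i)) (h a) B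
      (h-cong (elem A i) a (≈-sym {x = a} {elem A i} e)) hi∈B

  preimage-mono : ∀ B C → B ⊆ C → preimage h A B ⊆ preimage h A C
  preimage-mono B C B⊆C a a∈ =
    let (a∈A , ha∈B) = preimage⁻ B a a∈ in preimage⁺ C a a∈A (B⊆C (h a) ha∈B)

  preimage-cong : Congruent (preimage h A)
  preimage-cong B C e = ⊆-antisym (preimage h A B) (preimage h A C)
    (preimage-mono B C (≈⇒⊆ B C e)) (preimage-mono C B (≈⇒⊇ B C e))

  image-preimage : ∀ B → B ⊆ image h A → image h (preimage h A B) ≈ B
  image-preimage B B⊆hA = ⊆-antisym (image h (preimage h A B)) B
    (λ { ξ ((i , hi∈B) , e) → ∈-respˡ (h (elem A i)) ξ B (≈-sym {x = ξ} {h (elem A i)} e) hi∈B })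
    (λ ξ ξ∈B → let (i , e) = B⊆hA ξ ξ∈B in (i , ∈-respˡ ξ (h (elem A i)) B e ξ∈B) , e)

-- Cardinality

⊆⇒≼ : (X Y : V ℓ) → X ⊆ Y → X ≼ Y
⊆⇒≼ X Y X⊆Y = record
  { to        = λ (x , x∈X) → x , X⊆Y x x∈X
  ; cong      = λ e → e
  ; injective = λ e → e
  }

≼-trans : (X Y Z : V ℓ) → X ≼ Y → Y ≼ Z → X ≼ Z
≼-trans _ _ _ = Composition.injection

≼-≺-trans : (X Y Z : V ℓ) → X ≼ Y → Y ≺ Z → X ≺ Z
≼-≺-trans X Y Z X≼Y (Y≼Z , Z⋠Y) =
  ≼-trans X Y Z X≼Y Y≼Z , λ Z≼X → Z⋠Y (≼-trans Z X Y Z≼X X≼Y)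

≃-sym : (X Y : V ℓ) → X ≃ Y → Y ≃ X
≃-sym _ _ X≃Y = Inverses.Inverse⇒Bijection (Inverses.sym (Bijections.Bijection⇒Inverse X≃Y))

｛｝≼ : (x X : V ℓ) → ∃[ y ] y ∈ X → ｛ x ｝ ≼ X
｛｝≼ x X (y , y∈X) = record
  { to        = λ _ → y , y∈X
  ; cong      = λ _ → ≈-refl {x = y}
  ; injective = λ { {u , _ , u≈x} {v , _ , v≈x} _ →
      ≈-trans {x = u} {x} {v} u≈x (≈-sym {x = v} {x} v≈x) }
  }

-- Choice selects from each fibre of `h` one point; `h` maps it back to the value it came from,
-- whence injectivity. Equal values have equal fibres, so the selection respects `≈`.
image-≼ : Choice ℓ → (h : V ℓ → V ℓ) → Congruent h → (X : V ℓ) → image h X ≼ X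
image-≼ {ℓ} ac h h-cong X = record
  { to        = λ (y , i , e) →
      let (k , e′) = pick∈ (y , i , e) in pick (y , i , e) , proj₁ k , e′
  ; cong      = λ { {y , _} {z , _} e → Func.cong choice (fibre-cong y z e) }
  ; injective = λ { {u} {v} e →
      ≈-trans {x = proj₁ u} {h (pick u)} {proj₁ v} (pick-section u)
        (≈-trans {x = h (pick u)} {h (pick v)} {proj₁ v} (h-cong (pick u) (pick v) e)
          (≈-sym {x = proj₁ v} {h (pick v)} (pick-section v))) }
  }
  where
  fibre : V ℓ → V ℓ
  fibre y = sup (Σ[ i ∈ Index X ] y ≈ h (elem X i)) (elem X ∘ proj₁)

  fibre-⊆ : ∀ y z → y ≈ z → fibre y ⊆ fibre z
  fibre-⊆ y z y≈z x ((i , e) , e′) =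
    (i , ≈-trans {x = z} {y} {h (elem X i)} (≈-sym {x = y} {z} y≈z) e) , e′

  fibre-cong : Congruent fibre
  fibre-cong y z e = ⊆-antisym (fibre y) (fibre z)
    (fibre-⊆ y z e) (fibre-⊆ z y (≈-sym {x = y} {z} e))

  fibres : V ℓ
  fibres = image (fibre ∘ h) X

  inhabited : ∀ F → F ∈ fibres → ∃[ x ] x ∈ F
  inhabited F (i , e) = elem X i ,
    ≈⇒⊇ F (fibre (h (elem X i))) e (elem X i)
      ((i , ≈-refl {x = h (elem X i)}) , ≈-refl {x = elem X i})

  choice : Func (El fibres) (V-setoid ℓ)
  choice = proj₁ (ac fibres inhabited)

  -- `choice` is defined on members of `fibres` up to `≈`, so the fibre over `y` itself may be used
  -- instead of the listed fibre over `h (elem X i)`.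
  fibreOf : Setoid.Carrier (El (image h X)) → Setoid.Carrier (El fibres)
  fibreOf (y , i , e) = fibre y , i , fibre-cong y (h (elem X i)) e

  pick : Setoid.Carrier (El (image h X)) → V ℓ
  pick u = Func.to choice (fibreOf u)

  pick∈ : ∀ u → pick u ∈ fibre (proj₁ u)
  pick∈ u = proj₂ (ac fibres inhabited) (fibreOf u)

  pick-section : ∀ u → proj₁ u ≈ h (pick u)
  pick-section u =
    let ((i , e) , e′) = pick∈ u
    in ≈-trans {x = proj₁ u} {h (elem X i)} {h (pick u)} e
         (h-cong (elem X i) (pick u) (≈-sym {x = pick u} {elem X i} e′))

-- Ordinals

IsTransitive-resp : (x y : V ℓ) → x ≈ y → IsTransitive x → IsTransitive y
IsTransitive-resp x y e x-trans z z∈y w w∈z =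
  ≈⇒⊆ x y e w (x-trans z (≈⇒⊇ x y e z z∈y) w w∈z)

∈-ordinal : (α β : V ℓ) → IsOrdinal α → β ∈ α → IsOrdinal β
∈-ordinal α β (α-trans , α-elems) β∈α =
  α-elems β β∈α , λ γ γ∈β → α-elems γ (α-trans β β∈α γ γ∈β)

⋃-ordinal : (X : V ℓ) → (∀ x → x ∈ X → IsOrdinal x) → IsOrdinal (⋃ X)
⋃-ordinal X ord =
  (λ y y∈⋃X z z∈y →
    let (x , x∈X , y∈x) = ⋃⁻ X y y∈⋃X
    in ⋃⁺ X x z (proj₁ (ord x x∈X) y y∈x z z∈y) x∈X) ,
  (λ y y∈⋃X → let (x , x∈X , y∈x) = ⋃⁻ X y y∈⋃X in proj₂ (ord x x∈X) y y∈x)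

≤-∈-trans : (α β γ : V ℓ) → IsOrdinal γ → α ≤ β → β ∈ γ → α ∈ γ
≤-∈-trans α β γ γ-ord (inj₁ α∈β) β∈γ = proj₁ γ-ord β β∈γ α α∈β
≤-∈-trans α β γ γ-ord (inj₂ α≈β) β∈γ = ∈-respˡ β α γ (≈-sym {x = α} {β} α≈β) β∈γ

≤-trans : (α β γ : V ℓ) → IsOrdinal γ → α ≤ β → β ≤ γ → α ≤ γ
≤-trans α β γ γ-ord α≤β        (inj₁ β∈γ) = inj₁ (≤-∈-trans α β γ γ-ord α≤β β∈γ)
≤-trans α β γ γ-ord (inj₁ α∈β) (inj₂ β≈γ) = inj₁ (≈⇒⊆ β γ β≈γ α α∈β)
≤-trans α β γ γ-ord (inj₂ α≈β) (inj₂ β≈γ) = inj₂ (≈-trans {x = α} {β} {γ} α≈β β≈γ)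

⌜⌝-elements : ∀ n (x : V ℓ) → x ∈ ⌜ n ⌝ → ∃[ m ] x ≈ ⌜ m ⌝
⌜⌝-elements zero    x (() , _)
⌜⌝-elements (ℕ.suc n) x (inj₁ i , e) = ⌜⌝-elements n x (i , e)
⌜⌝-elements (ℕ.suc n) x (inj₂ _ , e) = n , e

⌜⌝-transitive : ∀ n → IsTransitive {ℓ} ⌜ n ⌝
⌜⌝-transitive zero    x (() , _)
⌜⌝-transitive (ℕ.suc n) x (inj₁ i , e) y y∈x =
  let (j , e′) = ⌜⌝-transitive n x (i , e) y y∈x in inj₁ j , e′
⌜⌝-transitive (ℕ.suc n) x (inj₂ _ , e) y y∈x =
  let (j , e′) = ≈⇒⊆ x ⌜ n ⌝ e y y∈x in inj₁ j , e′

ω-ordinal : IsOrdinal {ℓ} ω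
ω-ordinal =
  (λ x (n , e) y y∈x →
    let (m , e′) = ⌜⌝-elements (lower n) y (≈⇒⊆ x ⌜ lower n ⌝ e y y∈x) in lift m , e′) ,
  (λ x (n , e) → IsTransitive-resp ⌜ lower n ⌝ x (≈-sym {x = x} {⌜ lower n ⌝} e)
    (⌜⌝-transitive (lower n)))

-- On S this is the Mostowski collapse of (S , ∈).
collapse : V ℓ → V ℓ → V ℓ
collapse S (sup A f) = sup (Σ[ a ∈ A ] f a ∈ S) (λ (a , _) → collapse S (f a))

collapse-cong : (S : V ℓ) → Congruent (collapse S)
collapse-cong S (sup A f) (sup B g) (p , q) =
  (λ (a , fa∈S) → let (b , e) = p a in
    (b , ∈-respˡ (f a) (g b) S e fa∈S) , collapse-cong S (f a) (g b) e) ,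
  (λ (b , gb∈S) → let (a , e) = q b in
    (a , ∈-respˡ (g b) (f a) S (≈-sym {x = f a} {g b} e) gb∈S) , collapse-cong S (f a) (g b) e)

collapse⁺ : (S x y : V ℓ) → y ∈ x → y ∈ S → collapse S y ∈ collapse S x
collapse⁺ S (sup A f) y (a , e) y∈S =
  (a , ∈-respˡ y (f a) S e y∈S) , collapse-cong S y (f a) e

collapse⁻ : (S x z : V ℓ) → z ∈ collapse S x → ∃[ y ] y ∈ x × y ∈ S × z ≈ collapse S y
collapse⁻ S (sup A f) z ((a , fa∈S) , e) = f a , (a , ≈-refl {x = f a}) , fa∈S , e

-- A member of a member of `collapse S x` is the collapse of some `v ∈ y ∈ x` with `v ∈ S`, and
-- transitivity of `x` gives `v ∈ x`.
collapse-transitive : (S x : V ℓ) → IsTransitive x → IsTransitive (collapse S x)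
collapse-transitive S x x-trans z z∈ w w∈z =
  let (y , y∈x , _ , z≈y) = collapse⁻ S x z z∈
      (v , v∈y , v∈S , w≈v) = collapse⁻ S y w (≈⇒⊆ z (collapse S y) z≈y w w∈z)
  in ∈-respˡ (collapse S v) w (collapse S x) (≈-sym {x = w} {collapse S v} w≈v)
       (collapse⁺ S x v (x-trans y y∈x v v∈y) v∈S)

collapse-ordinal : (S α : V ℓ) → IsOrdinal α → IsOrdinal (collapse S α)
collapse-ordinal S α (α-trans , α-elems) =
  collapse-transitive S α α-trans ,
  λ z z∈ →
    let (y , y∈α , _ , z≈y) = collapse⁻ S α z z∈
    in IsTransitive-resp (collapse S y) z (≈-sym {x = z} {collapse S y} z≈y)
         (collapse-transitive S y (α-elems y y∈α))

-- Fibres and heights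

module _ (h : V ℓ → V ℓ) (A : V ℓ) where

  -- This is the largest subset of `κ` whose preimage in `A` lies inside `Z`, by
  -- `preimage-coverable` and `⊆-coverable`. Points with empty fibre belong to it vacuously.
  -- Quantifying over indices of `A` keeps the condition small.
  coverable : V ℓ → V ℓ → V ℓ
  coverable κ Z =
    sup (Σ[ j ∈ Index κ ] (∀ i → h (elem A i) ≈ elem κ j → elem A i ∈ Z)) (elem κ ∘ proj₁)

  coverable-⊆ : ∀ κ Z → coverable κ Z ⊆ κ
  coverable-⊆ κ Z x ((j , _) , e) = j , e

  coverable-mono : ∀ κ Y Z → Y ⊆ Z → coverable κ Y ⊆ coverable κ Z
  coverable-mono κ Y Z Y⊆Z x ((j , cov) , e) = (j , λ i e′ → Y⊆Z (elem A i) (cov i e′)) , e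

  coverable-cong : ∀ κ → Congruent (coverable κ)
  coverable-cong κ Y Z e = ⊆-antisym (coverable κ Y) (coverable κ Z)
    (coverable-mono κ Y Z (≈⇒⊆ Y Z e)) (coverable-mono κ Z Y (≈⇒⊇ Y Z e))

  module _ (h-cong : Congruent h) where

    preimage-coverable : ∀ κ Z → preimage h A (coverable κ Z) ⊆ Z
    preimage-coverable κ Z a a∈ =
      let ((i , a≈i) , ((j , cov) , ha≈j)) = preimage⁻ h h-cong A (coverable κ Z) a a∈
          hi≈ha = h-cong (elem A i) a (≈-sym {x = a} {elem A i} a≈i)
      in ∈-respˡ (elem A i) a Z (≈-sym {x = a} {elem A i} a≈i)
           (cov i (≈-trans {x = h (elem A i)} {h a} {elem κ j} hi≈ha ha≈j))

    ⊆-coverable : ∀ κ Z B → B ⊆ κ → preimage h A B ⊆ Z → B ⊆ coverable κ Z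
    ⊆-coverable κ Z B B⊆κ pre⊆Z b b∈B =
      let (j , b≈j) = B⊆κ b b∈B
      in (j , λ i hi≈j → pre⊆Z (elem A i) (preimage⁺ h h-cong A B (elem A i) (elem-∈ A i)
               (∈-respˡ b (h (elem A i)) B
                 (≈-trans {x = b} {elem κ j} {h (elem A i)} b≈j
                   (≈-sym {x = h (elem A i)} {elem κ j} hi≈j)) b∈B)))
         , b≈j

height-mono : (κ a b : V ℓ) → a ⊆ b → height κ a ⊆ height κ b
height-mono κ a b a⊆b = ⋃-mono (a ∩ κ) (b ∩ κ) λ x x∈ →
  let (x∈a , x∈κ) = ∩⁻ a κ x x∈ in ∩⁺ b κ x (a⊆b x x∈a) x∈κ

height-cong : (κ : V ℓ) → Congruent (height κ)
height-cong κ a b e = ⊆-antisym (height κ a) (height κ b)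
  (height-mono κ a b (≈⇒⊆ a b e)) (height-mono κ b a (≈⇒⊇ a b e))

HasOrderType-resp : (B C α : V ℓ) → B ≈ C → HasOrderType B α → HasOrderType C α
HasOrderType-resp B C α B≈C (f , iso) =
  (λ ξ → proj₁ (f ξ) , ≈⇒⊆ B C B≈C (proj₁ (f ξ)) (proj₂ (f ξ))) , record
    { isOrderMonomorphism = record
        { isOrderHomomorphism = record
            { cong = λ {x} {y} → iso.cong {x} {y}
            ; mono = λ {x} {y} → iso.mono {x} {y}
            }
        ; injective = λ {x} {y} → iso.injective {x} {y}
        ; cancel    = λ {x} {y} → iso.cancel {x} {y}
        }
    ; surjective = λ (c , c∈C) → iso.surjective (c , ≈⇒⊇ B C B≈C c c∈C)
    }
  where module iso = IsOrderIsomorphism iso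

-- Classical set theory

module _ {ℓ : Level} (em : ExcludedMiddle (suc ℓ)) where
  open Classical em

  private
    em↓ : ExcludedMiddle ℓ
    em↓ = map′ lower lift em

  sep⁺ : ∀ X (Q : Pred (V ℓ) (suc ℓ)) → (∀ x y → x ≈ y → Q x → Q y) →
         ∀ x → x ∈ X → Q x → x ∈ sep X Q
  sep⁺ X Q Q-resp x (i , e) Qx = (i , fromWitness {a? = em} (Q-resp x (elem X i) e Qx)) , e

  sep⁻ : ∀ X (Q : Pred (V ℓ) (suc ℓ)) → (∀ x y → x ≈ y → Q x → Q y) →
         ∀ x → x ∈ sep X Q → x ∈ X × Q x
  sep⁻ X Q Q-resp x ((i , Qi) , e) =
    (i , e) , Q-resp (elem X i) x (≈-sym {x = x} {elem X i} e) (toWitness {a? = em} Qi)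

  -- Members of `𝒫 X` are given by Boolean functions on the index type; excluded middle turns `x`
  -- into its characteristic function.
  𝒫⁺ : ∀ X x → x ⊆ X → x ∈ 𝒫 X
  𝒫⁺ X x x⊆X = (λ i → ⌊ em↓ {elem X i ∈ x} ⌋) , ⊆-antisym x _
    (λ y y∈x → let (i , e) = x⊆X y y∈x in
      (i , fromWitness {a? = em↓} (∈-respˡ y (elem X i) x e y∈x)) , e)
    (λ { y ((i , i∈x) , e) →
      ∈-respˡ (elem X i) y x (≈-sym {x = y} {elem X i} e) (toWitness {a? = em↓} i∈x) })

  𝒫⁻ : ∀ X x → x ∈ 𝒫 X → x ⊆ X
  𝒫⁻ X x (χ , e) y y∈x =
    let ((i , _) , e′) = ≈⇒⊆ x (elem (𝒫 X) χ) e y y∈x in i , e′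

  ≺-resp : (μ x y : V ℓ) → x ≈ y → x ≺ μ → y ≺ μ
  ≺-resp μ x y e = ≼-≺-trans y x μ (⊆⇒≼ y x (≈⇒⊇ x y e))

  P⁺ : ∀ μ X a → a ⊆ X → a ≺ μ → a ∈ P μ X
  P⁺ μ X a a⊆X = sep⁺ (𝒫 X) (_≺ μ) (≺-resp μ) a (𝒫⁺ X a a⊆X)

  P⁻ : ∀ μ X a → a ∈ P μ X → a ⊆ X × a ≺ μ
  P⁻ μ X a a∈P =
    let (a∈𝒫 , a≺μ) = sep⁻ (𝒫 X) (_≺ μ) (≺-resp μ) a a∈P in 𝒫⁻ X a a∈𝒫 , a≺μ

  I⁺ : ∀ κ λ′ A a → A ⊆ P κ λ′ → a ∈ P κ λ′ →
       (∀ b → b ∈ P κ λ′ → a ⊆ b → ¬ (b ∈ A)) → A ∈ I κ λ′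
  I⁺ κ λ′ A a A⊆P a∈P avoid = sep⁺ (𝒫 (P κ λ′))
    (λ A → ∃[ a ] a ∈ P κ λ′ × (∀ b → b ∈ P κ λ′ → a ⊆ b → ¬ (b ∈ A)))
    (λ x y e (c , c∈P , av) → c , c∈P , λ b b∈P c⊆b b∈y → av b b∈P c⊆b (≈⇒⊇ x y e b b∈y))
    A (𝒫⁺ (P κ λ′) A A⊆P) (a , a∈P , avoid)

  -- Nested ∈-induction, first on `α`, then on `β`. If neither ordinal is a member of the other,
  -- comparing each element of one with the other ordinal shows that the two have the same elements.
  trichotomy : ∀ α β → IsOrdinal α → IsOrdinal β → α ∈ β ⊎ (α ≈ β ⊎ β ∈ α)
  trichotomy α β α-ord β-ord =
    ∈-induction {ℓ} {suc ℓ} (λ α → ∀ β → IsOrdinal α → IsOrdinal β → α ∈ β ⊎ (α ≈ β ⊎ β ∈ α))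
      (λ α ihα → ∈-induction _ (step α ihα)) α β α-ord β-ord
    where
    step : ∀ α → (∀ x → x ∈ α → ∀ β → IsOrdinal x → IsOrdinal β → x ∈ β ⊎ (x ≈ β ⊎ β ∈ x)) →
           ∀ β → (∀ y → y ∈ β → IsOrdinal α → IsOrdinal y → α ∈ y ⊎ (α ≈ y ⊎ y ∈ α)) →
           IsOrdinal α → IsOrdinal β → α ∈ β ⊎ (α ≈ β ⊎ β ∈ α)
    step α ihα β ihβ α-ord β-ord with em↓ {α ∈ β} | em↓ {β ∈ α}
    ... | yes α∈β | _       = inj₁ α∈β
    ... | no _    | yes β∈α = inj₂ (inj₂ β∈α)
    ... | no α∉β  | no β∉α  = inj₂ (inj₁ (⊆-antisym α β α⊆β β⊆α))
      where
      α⊆β : α ⊆ β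
      α⊆β x x∈α with ihα x x∈α β (∈-ordinal α x α-ord x∈α) β-ord
      ... | inj₁ x∈β        = x∈β
      ... | inj₂ (inj₁ x≈β) = contradiction (∈-respˡ x β α x≈β x∈α) β∉α
      ... | inj₂ (inj₂ β∈x) = contradiction (proj₁ α-ord x x∈α β β∈x) β∉α
      β⊆α : β ⊆ α
      β⊆α y y∈β with ihβ y y∈β α-ord (∈-ordinal β y β-ord y∈β)
      ... | inj₁ α∈y        = contradiction (proj₁ β-ord y y∈β α α∈y) α∉β
      ... | inj₂ (inj₁ α≈y) = contradiction (∈-respˡ y α β (≈-sym {x = α} {y} α≈y) y∈β) α∉β
      ... | inj₂ (inj₂ y∈α) = y∈α

  ∉⇒≤ : ∀ α β → IsOrdinal α → IsOrdinal β → ¬ (β ∈ α) → α ≤ β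
  ∉⇒≤ α β α-ord β-ord β∉α with trichotomy α β α-ord β-ord
  ... | inj₁ α∈β        = inj₁ α∈β
  ... | inj₂ (inj₁ α≈β) = inj₂ α≈β
  ... | inj₂ (inj₂ β∈α) = contradiction β∈α β∉α

  ⊆⇒≤ : ∀ α β → IsOrdinal α → IsOrdinal β → α ⊆ β → α ≤ β
  ⊆⇒≤ α β α-ord β-ord α⊆β = ∉⇒≤ α β α-ord β-ord λ β∈α → ∈-irrefl β (α⊆β β β∈α)

  -- Foundation: ∈-induction descends to a member satisfying `Q` as long as there is one. For
  -- ordinals, an ∈-minimal witness is a least one.
  least-∈ : (Q : Pred (V ℓ) (suc ℓ)) → ∀ x → Q x → ∃[ y ] Q y × (∀ z → z ∈ y → ¬ Q z)
  least-∈ Q = ∈-induction _ step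
    where
    step : ∀ x → (∀ y → y ∈ x → Q y → ∃[ y ] Q y × (∀ z → z ∈ y → ¬ Q z)) →
           Q x → ∃[ y ] Q y × (∀ z → z ∈ y → ¬ Q z)
    step x ih Qx with em {∃[ y ] y ∈ x × Q y}
    ... | yes (y , y∈x , Qy) = ih y y∈x Qy
    ... | no none            = x , Qx , λ z z∈x Qz → none (z , z∈x , Qz)

  -- By induction `collapse S y ≤ y` for `y ∈ α`, so each member of the collapse lies at or below
  -- some member of `α`.
  collapse-⊆ : ∀ S α → IsOrdinal α → collapse S α ⊆ α
  collapse-⊆ S = ∈-induction _ λ α ih α-ord z z∈ →
    let (y , y∈α , _ , z≈y) = collapse⁻ S α z z∈
        y-ord = ∈-ordinal α y α-ord y∈α
    in ∈-respˡ (collapse S y) z α (≈-sym {x = z} {collapse S y} z≈y)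
         (≤-∈-trans (collapse S y) y α α-ord
           (⊆⇒≤ (collapse S y) y (collapse-ordinal S y y-ord) y-ord (ih y y∈α y-ord)) y∈α)

  -- On `S` the collapse preserves `∈`; two comparable but different ordinals with equal collapses
  -- would give a set that is a member of itself.
  collapse-injective : ∀ S α β → IsOrdinal α → IsOrdinal β → α ∈ S → β ∈ S →
                       collapse S α ≈ collapse S β → α ≈ β
  collapse-injective S α β α-ord β-ord α∈S β∈S e with trichotomy α β α-ord β-ord
  ... | inj₁ α∈β        = contradiction
    (≈⇒⊇ (collapse S α) (collapse S β) e (collapse S α) (collapse⁺ S β α α∈β α∈S))
    (∈-irrefl (collapse S α))
  ... | inj₂ (inj₁ α≈β) = α≈β
  ... | inj₂ (inj₂ β∈α) = contradiction
    (≈⇒⊆ (collapse S α) (collapse S β) e (collapse S β) (collapse⁺ S α β β∈α β∈S))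
    (∈-irrefl (collapse S β))

  -- The injection maps `X` onto a set `S` of ordinals below `β`. Collapsing `β` along `S` gives the
  -- order type of `S`, which is the required `γ`.
  ≼⇒≃-ordinal : ∀ X β → IsOrdinal β → X ≼ β → ∃[ γ ] IsOrdinal γ × γ ≤ β × X ≃ γ
  ≼⇒≃-ordinal X β β-ord X≼β =
    collapse S β , γ-ord , ⊆⇒≤ (collapse S β) β γ-ord β-ord (collapse-⊆ S β β-ord) , record
      { to        = λ u → collapse S (g u) , collapse⁺ S β (g u) (g∈β u) (g∈S u)
      ; cong      = λ {u} {v} e → collapse-cong S (g u) (g v) (X≼β.cong {u} {v} e)
      ; bijective =
          (λ {u} {v} e → X≼β.injective {u} {v}
            (collapse-injective S (g u) (g v)
              (∈-ordinal β (g u) β-ord (g∈β u)) (∈-ordinal β (g v) β-ord (g∈β v))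
              (g∈S u) (g∈S v) e)) ,
          (λ (z , z∈) →
            let (y , _ , (i , y≈gi) , z≈y) = collapse⁻ S β z z∈
                u = elem X i , elem-∈ X i
            in u , λ {v} v≈u →
              ≈-trans {x = collapse S (g v)} {collapse S y} {z}
                (collapse-cong S (g v) y
                  (≈-trans {x = g v} {g u} {y} (X≼β.cong {v} {u} v≈u) (≈-sym {x = y} {g u} y≈gi)))
                (≈-sym {x = z} {collapse S y} z≈y))
      }
    where
    module X≼β = Injection X≼β

    g : Setoid.Carrier (El X) → V ℓ
    g u = proj₁ (X≼β.to u)

    g∈β : ∀ u → g u ∈ β
    g∈β u = proj₂ (X≼β.to u)

    S : V ℓ
    S = sup (Index X) (λ i → g (elem X i , elem-∈ X i))

    g∈S : ∀ u → g u ∈ S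
    g∈S (x , i , e) = i , X≼β.cong {x , i , e} {elem X i , elem-∈ X i} e

    γ-ord : IsOrdinal (collapse S β)
    γ-ord = collapse-ordinal S β β-ord

  -- Besides bounding the cofinality, this shows that it exists: `Y` is equinumerous with an ordinal
  -- `γ ≤ σ`, so there is a least ordinal `τ` equinumerous with some generating set.
  generator⇒cof : ∀ K Y σ → Generates K Y → IsOrdinal σ → Y ≼ σ → ∃[ τ ] IsCof K τ × τ ≤ σ
  generator⇒cof K Y σ gen σ-ord Y≼σ =
    let (γ , γ-ord , γ≤σ , Y≃γ) = ≼⇒≃-ordinal Y σ σ-ord Y≼σ
        (τ , (τ-ord , Z , genZ , Z≃τ) , τ-least) = least-∈ Q γ (γ-ord , Y , gen , Y≃γ)
        τ≤γ = ∉⇒≤ τ γ τ-ord γ-ord λ γ∈τ → τ-least γ γ∈τ (γ-ord , Y , gen , Y≃γ)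
        -- `Q` asks only for an ordinal. A smaller `β ≃ τ` would be equinumerous with the same
        -- generating set `Z`, so leastness makes `τ` initial.
        τ-card = τ-ord , λ β β∈τ β≃τ → τ-least β β∈τ
          (∈-ordinal τ β τ-ord β∈τ , Z , genZ ,
           Composition.bijection Z≃τ (≃-sym β τ β≃τ))
    in τ ,
       (τ-card , (Z , genZ , Z≃τ) ,
        λ ρ ρ-card (Y′ , gen′ , Y′≃ρ) →
          ∉⇒≤ τ ρ τ-ord (proj₁ ρ-card) λ ρ∈τ → τ-least ρ ρ∈τ (proj₁ ρ-card , Y′ , gen′ , Y′≃ρ)) ,
       ≤-trans τ γ σ σ-ord τ≤γ γ≤σ
    where
    Q : Pred (V ℓ) (suc ℓ)
    Q τ = IsOrdinal τ × ∃[ Z ] Generates K Z × Z ≃ τ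

  -- The pushforward of an ideal

  module Pushforward
    (ac : Choice ℓ) (h : V ℓ → V ℓ) (h-cong : Congruent h) (κ A S H : V ℓ)
    (H-ideal : IsIdeal S H)
    where

    private module H = IsIdeal H-ideal

    pushforward : V ℓ
    pushforward = sep (𝒫 κ) (λ B → Lift (suc ℓ) (preimage h A B ∈ H))

    private
      resp : ∀ B C → B ≈ C → Lift (suc ℓ) (preimage h A B ∈ H) → Lift (suc ℓ) (preimage h A C ∈ H)
      resp B C e (lift B∈) = lift (∈-respˡ (preimage h A B) (preimage h A C) H
        (preimage-cong h h-cong A B C e) B∈)

    pushforward⁺ : ∀ B → B ⊆ κ → preimage h A B ∈ H → B ∈ pushforward
    pushforward⁺ B B⊆κ B∈ = sep⁺ (𝒫 κ) _ resp B (𝒫⁺ κ B B⊆κ) (lift B∈)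

    pushforward⁻ : ∀ B → B ∈ pushforward → B ⊆ κ × preimage h A B ∈ H
    pushforward⁻ B B∈ =
      let (B∈𝒫 , lift B∈H) = sep⁻ (𝒫 κ) _ resp B B∈ in 𝒫⁻ κ B B∈𝒫 , B∈H

    -- Closure properties pass from `H` because preimages respect inclusions and unions. Singletons
    -- need small fibres, and properness holds because the preimage of `κ` is all of `A`.
    pushforward-isIdeal :
      ω ≼ κ → (∀ a → a ∈ A → h a ∈ κ) →
      (∀ ξ → ξ ∈ κ → preimage h A ｛ ξ ｝ ∈ H) → ¬ (A ∈ H) →
      IsIdeal κ pushforward
    pushforward-isIdeal ω≼κ h∈κ fibre∈H A∉H = record
      { infinite   = ω≼κ
      ; subsets    = λ B B∈ → proj₁ (pushforward⁻ B B∈)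
      ; singletons = λ ξ ξ∈κ → pushforward⁺ ｛ ξ ｝ (｛｝-⊆ ξ κ ξ∈κ) (fibre∈H ξ ξ∈κ)
      ; downward   = λ B C B∈ C⊆B →
          let (B⊆κ , pB) = pushforward⁻ B B∈
          in pushforward⁺ C (λ x x∈C → B⊆κ x (C⊆B x x∈C))
               (H.downward (preimage h A B) (preimage h A C) pB
                 (preimage-mono h h-cong A C B C⊆B))
      ; unions     = λ B C B∈ C∈ →
          let (B⊆κ , pB) = pushforward⁻ B B∈
              (C⊆κ , pC) = pushforward⁻ C C∈
          in pushforward⁺ (B ∪ C)
               (λ { x (inj₁ i , e) → B⊆κ x (i , e) ; x (inj₂ i , e) → C⊆κ x (i , e) })
               (H.downward (preimage h A B ∪ preimage h A C) (preimage h A (B ∪ C))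
                 (H.unions (preimage h A B) (preimage h A C) pB pC)
                 (λ { x ((i , inj₁ j , e) , e′) → inj₁ (i , j , e) , e′
                    ; x ((i , inj₂ j , e) , e′) → inj₂ (i , j , e) , e′ }))
      ; proper     = λ κ∈ →
          A∉H (H.downward (preimage h A κ) A (proj₂ (pushforward⁻ κ κ∈))
            λ a a∈A → preimage⁺ h h-cong A κ a a∈A (h∈κ a a∈A))
      }

    -- The preimage of `⋃ X` is covered by the preimages of the members of `X`. These form an image
    -- of `X`, so by `image-≼` there are still fewer than `μ` of them.
    pushforward-complete : ∀ μ → IsComplete μ H → IsComplete μ pushforward
    pushforward-complete μ H-complete X X⊆J X≺μ = pushforward⁺ (⋃ X)
      (λ y y∈ → let (B , B∈X , y∈B) = ⋃⁻ X y y∈ in proj₁ (pushforward⁻ B (X⊆J B B∈X)) y y∈B)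
      (H.downward (⋃ Y) (preimage h A (⋃ X))
        (H-complete Y Y⊆H
          (≼-≺-trans Y X μ (image-≼ ac (preimage h A) (preimage-cong h h-cong A) X) X≺μ))
        (λ a a∈ →
          let (a∈A , ha∈) = preimage⁻ h h-cong A (⋃ X) a a∈
              (B , B∈X , ha∈B) = ⋃⁻ X (h a) ha∈
          in ⋃⁺ Y (preimage h A B) a (preimage⁺ h h-cong A B a a∈A ha∈B)
               (image⁺ (preimage h A) (preimage-cong h h-cong A) X B B∈X)))
      where
      Y : V ℓ
      Y = image (preimage h A) X

      Y⊆H : Y ⊆ H
      Y⊆H y (i , e) = ∈-respˡ (preimage h A (elem X i)) y H
        (≈-sym {x = y} {preimage h A (elem X i)} e)
        (proj₂ (pushforward⁻ (elem X i) (X⊆J (elem X i) (elem-∈ X i))))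

    -- If a generator `Z` contains the preimage of `B`, then `B ⊆ coverable h A κ Z` by maximality;
    -- and the latter is in the pushforward because its own preimage lies in `Z`.
    pushforward-generates : ∀ X → Generates H X → Generates pushforward (image (coverable h A κ) X)
    pushforward-generates X (X⊆H , X-gen) = Y⊆J , λ B → mk⇔
      (λ B∈ →
        let (B⊆κ , pB) = pushforward⁻ B B∈
            (Z , Z∈X , pB⊆Z) = Equivalence.to (X-gen (preimage h A B)) pB
        in coverable h A κ Z ,
           image⁺ (coverable h A κ) (coverable-cong h A κ) X Z Z∈X ,
           ⊆-coverable h A h-cong κ Z B B⊆κ pB⊆Z)
      (λ (C , C∈Y , B⊆C) →
        let (C⊆κ , pC) = pushforward⁻ C (Y⊆J C C∈Y)
        in pushforward⁺ B (λ x x∈B → C⊆κ x (B⊆C x x∈B))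
             (H.downward (preimage h A C) (preimage h A B) pC
               (preimage-mono h h-cong A B C B⊆C)))
      where
      Y⊆J : image (coverable h A κ) X ⊆ pushforward
      Y⊆J C (i , e) = ∈-respˡ (coverable h A κ Z) C pushforward
        (≈-sym {x = C} {coverable h A κ Z} e)
        (pushforward⁺ (coverable h A κ Z) (coverable-⊆ h A κ Z)
          (H.downward Z (preimage h A (coverable h A κ Z)) (X⊆H Z (elem-∈ X i))
            (preimage-coverable h A h-cong κ Z)))
        where Z = elem X i

    pushforward-cof : ∀ σ → IsCof H σ → ∃[ τ ] IsCof pushforward τ × τ ≤ σ
    pushforward-cof σ ((σ-ord , _) , (X , X-gen , X≃σ) , _) =
      generator⇒cof pushforward (image (coverable h A κ) X) σ (pushforward-generates X X-gen) σ-ord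
        (≼-trans (image (coverable h A κ) X) X σ
          (image-≼ ac (coverable h A κ) (coverable-cong h A κ) X) (Bijection.injection X≃σ))

    preimage-positive : A ⊆ S → ∀ B → Positive κ pushforward B → Positive S H (preimage h A B)
    preimage-positive A⊆S B (B⊆κ , B∉J) =
      (λ a a∈ → A⊆S a (proj₁ (preimage⁻ h h-cong A B a a∈))) ,
      λ pB → B∉J (pushforward⁺ B B⊆κ pB)

    -- The preimage of `image h A` contains `A`, so it cannot be in `H`.
    image-positive : (∀ a → a ∈ A → h a ∈ κ) → ¬ (A ∈ H) → Positive κ pushforward (image h A)
    image-positive h∈κ A∉H =
      (λ { ξ (i , e) → ∈-respˡ (h (elem A i)) ξ κ (≈-sym {x = ξ} {h (elem A i)} e)
             (h∈κ (elem A i) (elem-∈ A i)) }) ,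
      λ hA∈J → A∉H (H.downward (preimage h A (image h A)) A (proj₂ (pushforward⁻ (image h A) hA∈J))
        λ a a∈A → preimage⁺ h h-cong A (image h A) a a∈A (image⁺ h h-cong A a a∈A))

  -- If the relation failed for `J`, leastness of `ν` would give `ν ≤ τ ∈ ν`. Excluded middle
  -- removes the double negation.
  non⇒Arrow : ∀ κ α J τ ν → IsIdealOnκ κ J → IsCof J τ → IsNon κ α ν → τ ∈ ν → Arrow κ J α
  non⇒Arrow κ α J τ ν J-ideal τ-cof@(τ-card , _) (ν-card , _ , ν-least) τ∈ν =
    decidable-stable em λ ¬arrow →
      ∈-irrefl ν (≤-∈-trans ν τ ν (proj₁ ν-card)
        (ν-least τ τ-card (J , J-ideal , τ-cof , ¬arrow)) τ∈ν)

  -- Heights and colourings over a regular uncountable cardinal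

  module _ (κ : V ℓ) (κ-ord : IsOrdinal κ) (κ-uncountable : Uncountable κ) where

    ω≼κ : ω ≼ κ
    ω≼κ with trichotomy ω κ ω-ordinal κ-ord
    ... | inj₁ ω∈κ        = ⊆⇒≼ ω κ (proj₁ κ-ord ω ω∈κ)
    ... | inj₂ (inj₁ ω≈κ) = contradiction (⊆⇒≼ κ ω (≈⇒⊇ ω κ ω≈κ)) κ-uncountable
    ... | inj₂ (inj₂ κ∈ω) = contradiction (⊆⇒≼ κ ω (proj₁ ω-ordinal κ κ∈ω)) κ-uncountable

    ｛｝≺κ : ∀ ξ → ξ ∈ κ → ｛ ξ ｝ ≺ κ
    ｛｝≺κ ξ ξ∈κ = ⊆⇒≼ ｛ ξ ｝ κ (｛｝-⊆ ξ κ ξ∈κ) , λ κ≼｛ξ｝ →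
      κ-uncountable (≼-trans κ ｛ ξ ｝ ω κ≼｛ξ｝ (｛｝≼ ξ ω (∅ {ℓ} , lift 0 , ≈-refl {x = ∅ {ℓ}})))

    module _ (κ-regular : IsRegular κ) where

      -- Regularity bounds `a ∩ κ` by some `β ∈ κ`; its union is then an ordinal included in `β`.
      height∈κ : ∀ a → a ≺ κ → height κ a ∈ κ
      height∈κ a a≺κ =
        let (β , β∈κ , bound) = κ-regular (a ∩ κ) (λ x x∈ → proj₂ (∩⁻ a κ x x∈))
              (≼-≺-trans (a ∩ κ) a κ (⊆⇒≼ (a ∩ κ) a (λ x x∈ → proj₁ (∩⁻ a κ x x∈))) a≺κ)
            β-ord = ∈-ordinal κ β κ-ord β∈κ
            h-ord = ⋃-ordinal (a ∩ κ) (λ x x∈ → ∈-ordinal κ x κ-ord (proj₂ (∩⁻ a κ x x∈)))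
            h⊆β = λ y y∈ → let (x , x∈ , y∈x) = ⋃⁻ (a ∩ κ) y y∈
                           in proj₁ β-ord x (bound x x∈) y y∈x
        in ≤-∈-trans (height κ a) β κ κ-ord (⊆⇒≤ (height κ a) β h-ord β-ord h⊆β) β∈κ

      -- Take `β` with `ξ ∈ β ∈ κ`. Any `b` containing `β` has `ξ ∈ height κ b`, so its height is
      -- not `ξ`; thus `｛ β ｝` witnesses membership in `I κ λ′`.
      fibre-∈I : ∀ λ′ A ξ → κ ⊆ λ′ → A ⊆ P κ λ′ → ξ ∈ κ →
                 preimage (height κ) A ｛ ξ ｝ ∈ I κ λ′
      fibre-∈I λ′ A ξ κ⊆λ′ A⊆P ξ∈κ =
        -- Regularity applied to a singleton says that `κ` has no largest element.
        let (β , β∈κ , bound) = κ-regular ｛ ξ ｝ (｛｝-⊆ ξ κ ξ∈κ) (｛｝≺κ ξ ξ∈κ)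
            ξ∈β = bound ξ (elem-∈ ｛ ξ ｝ tt)
        in I⁺ κ λ′ (preimage (height κ) A ｛ ξ ｝) ｛ β ｝
             (λ a a∈ → A⊆P a (proj₁ (preimage⁻ (height κ) (height-cong κ) A ｛ ξ ｝ a a∈)))
             (P⁺ κ λ′ ｛ β ｝ (｛｝-⊆ β λ′ (κ⊆λ′ β β∈κ)) (｛｝≺κ β β∈κ))
             (λ b _ β⊆b b∈ →
               let (_ , _ , hb≈ξ) = preimage⁻ (height κ) (height-cong κ) A ｛ ξ ｝ b b∈
                   ξ∈hb = ⋃⁺ (b ∩ κ) β ξ ξ∈β (∩⁺ b κ β (β⊆b β (elem-∈ ｛ β ｝ tt)) β∈κ)
               in ∈-irrefl ξ (≈⇒⊆ (height κ b) ξ hb≈ξ ξ ξ∈hb))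

      image-[]² : ∀ λ′ A → A ⊆ P κ λ′ → ∀ x →
                  [ image (height κ) A ]² x → [ P κ λ′ ]²κκ κ x
      image-[]² λ′ A A⊆P (ξ , η) ((i , e) , (j , e′) , ξ∈η) =
        elem A i , elem A j , A⊆P _ (elem-∈ A i) , A⊆P _ (elem-∈ A j) , e , e′ , ξ∈η

      -- A colouring depends on the pair of heights alone, because `Pairs` compares only the pairs;
      -- which elements of `A` represent the heights is immaterial.
      restrict : ∀ λ′ A → A ⊆ P κ λ′ →
                 Colouring ([ P κ λ′ ]²κκ κ) → Colouring ([ image (height κ) A ]²)
      restrict λ′ A A⊆P F = record
        { to   = λ (x , x∈) → Func.to F (x , image-[]² λ′ A A⊆P x x∈)
        ; cong = λ { {x , x∈} {y , y∈} e →
            Func.cong F {x , image-[]² λ′ A A⊆P x x∈} {y , image-[]² λ′ A A⊆P y y∈} e }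
        }

      restrict-constant : ∀ λ′ A (A⊆P : A ⊆ P κ λ′) F B i → B ⊆ image (height κ) A →
        ConstantOn (restrict λ′ A A⊆P F) [ B ]² i →
        ConstantOn F ([ preimage (height κ) A B ]²κκ κ) i
      restrict-constant λ′ A A⊆P F B i B⊆hA constant
        (x@(ξ , η) , x∈) (a , b , a∈ , b∈ , ξ≈ , η≈ , ξ∈η) =
        -- The same pair carries two membership proofs, the given one and the one built by
        -- `image-[]²`; congruence of `F` identifies their colours.
        trans (Func.cong F {x , x∈} {x , image-[]² λ′ A A⊆P x x∈hA}
                (≈-refl {x = ξ} , ≈-refl {x = η}))
              (constant (x , x∈hA) (ξ∈B , η∈B , ξ∈η))
        where
        height∈B : ∀ ζ c → c ∈ preimage (height κ) A B → ζ ≈ height κ c → ζ ∈ B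
        height∈B ζ c c∈ ζ≈ = ∈-respˡ (height κ c) ζ B (≈-sym {x = ζ} {height κ c} ζ≈)
          (proj₂ (preimage⁻ (height κ) (height-cong κ) A B c c∈))

        ξ∈B : ξ ∈ B
        ξ∈B = height∈B ξ a a∈ ξ≈

        η∈B : η ∈ B
        η∈B = height∈B η b b∈ η≈

        x∈hA : [ image (height κ) A ]² x
        x∈hA = B⊆hA ξ ξ∈B , B⊆hA η η∈B , ξ∈η

theorem12p1 : ∀ {ℓ : Level} (em : ExcludedMiddle (suc ℓ)) (ac : Choice ℓ) →
    let open Classical em in
    (κ λ′ α H : V ℓ) →
    IsCardinal κ → Uncountable κ → IsRegular κ →
    IsCardinal λ′ → κ ∈ λ′ →
    IsOrdinal α → ⌜ 3 ⌝ ≤ α → α ≤ κ →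
    IsIdealOnP κ λ′ H →
    (cofH non : V ℓ) → IsCof H cofH → IsNon κ α non → cofH ∈ non →
    Arrowκκ κ λ′ H α
theorem12p1 {ℓ} em ac κ λ′ α H (κ-ord , _) κ-unc κ-reg ((λ′-trans , _) , _) κ∈λ′ _ _ _
  (H-ideal , H-complete , I⊆H) cofH non cofH-cof non-non cofH∈non F A (A⊆P , A∉H) =
  -- `τ` is the cofinality of the pushforward, and `τ ≤ cofH ∈ non` puts it below the threshold.
  let (τ , τ-cof , τ≤cofH) = pushforward-cof cofH cofH-cof
      τ∈non = ≤-∈-trans τ cofH non (proj₁ (proj₁ non-non)) τ≤cofH cofH∈non
      arrow = non⇒Arrow em κ α pushforward τ non
                (J-ideal , pushforward-complete κ H-complete) τ-cof non-non τ∈non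
      (B , B⊆hA , homogeneous) = arrow (image h A) (image-positive h∈κ A∉H)
                (restrict em κ κ-ord κ-unc κ-reg λ′ A A⊆P F)
  in preimage h A B ,
     (λ a a∈ → proj₁ (preimage⁻ h (height-cong κ) A B a a∈)) ,
     pullBack B B⊆hA homogeneous
  where
  open Classical em

  h : V ℓ → V ℓ
  h = height κ

  open Pushforward em ac h (height-cong κ) κ A (P κ λ′) H H-ideal

  h∈κ : ∀ a → a ∈ A → h a ∈ κ
  h∈κ a a∈A = height∈κ em κ κ-ord κ-unc κ-reg a (proj₂ (P⁻ em κ λ′ a (A⊆P a a∈A)))

  J-ideal : IsIdeal κ pushforward
  J-ideal = pushforward-isIdeal (ω≼κ em κ κ-ord κ-unc) h∈κ
    -- Fineness of `H` enters here: each fibre of the height map misses a cone, hence is in `H`.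
    (λ ξ ξ∈κ → I⊆H (preimage h A ｛ ξ ｝)
      (fibre-∈I em κ κ-ord κ-unc κ-reg λ′ A ξ (λ′-trans κ κ∈λ′) A⊆P ξ∈κ))
    A∉H

  -- Positivity transfers by the definition of the pushforward. In the other case `B ⊆ image h A`
  -- makes the heights of the preimage exactly `B`, so the order type is unchanged.
  pullBack : ∀ B → B ⊆ image h A →
    let f = restrict em κ κ-ord κ-unc κ-reg λ′ A A⊆P F in
      (Positive κ pushforward B × ConstantOn f [ B ]² 0F)
    ⊎ (HasOrderType B α × ConstantOn f [ B ]² 1F) →
      (Positive (P κ λ′) H (preimage h A B) × ConstantOn F ([ preimage h A B ]²κκ κ) 0F)
    ⊎ (HasOrderType (image h (preimage h A B)) α × ConstantOn F ([ preimage h A B ]²κκ κ) 1F)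
  pullBack B B⊆hA (inj₁ (B∈J⁺ , constant)) = inj₁
    (preimage-positive A⊆P B B∈J⁺ ,
     restrict-constant em κ κ-ord κ-unc κ-reg λ′ A A⊆P F B 0F B⊆hA constant)
  pullBack B B⊆hA (inj₂ (B-type , constant)) = inj₂
    (HasOrderType-resp B (image h (preimage h A B)) α
       (≈-sym {x = image h (preimage h A B)} {B}
         (image-preimage h (height-cong κ) A B B⊆hA)) B-type ,
     restrict-constant em κ κ-ord κ-unc κ-reg λ′ A A⊆P F B 1F B⊆hA constant)
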